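{- Let $p\ge q\ge 1$ be integers and let $\mathcal F\subseteq\binom{[p]}{q}$ be $q/p$-regular. Then $\mathrm{NRD}(\mathrm{OR\text{ - }DP}_{\mathcal F},n)=\Theta(n^{p/q})$, with implied constants depending only on $p$ and $q$.
   Context: Let $E_{p,q}=\{0,1\}^q$. For $x\in\{0,1\}^p$ and $S\in\binom{[p]}{q}$, $x|_S\in\{0,1\}^q$ denotes the restriction of $x$ to the coordinates in $S$ (listed in increasing order). Define $\mathrm{proj}_{\mathcal F}(x)=(x|_S : S\in\mathcal F)\in E_{p,q}^{\mathcal F}$ and $\mathrm{OR\text{ - }DP}_{\mathcal F}=\{\mathrm{proj}_{\mathcal F}(x): x\in\{0,1\}^p\setminus\{0^p\}\}$, a relation of arity $|\mathcal F|$ over $E_{p,q}$. $\mathcal F$ is $q/p$-regular if there is a probability distribution on $\mathcal F$ such that for every $i\in[p]$ a random $S$ contains $i$ with probability exactly $q/p$. For a finite set $D$ and relation $R\subseteq D^r$, an instance of $\mathrm{CSP}(R)$ is $(X,Y)$ with $X$ finite, $Y\subseteq X^r$; it is non-redundant if for each $y\in Y$ some $\sigma:X\to D$ maps every clause of $Y\setminus\{y\}$ into $R$ but not $y$; $\mathrm{NRD}(R,n)$ is the maximum $|Y|$ over non-redundant instances with $|X|=n$.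
   Formalization: The probability distribution witnessing that F is q/p-regular is required to have rational weights; a real distribution exists exactly when a rational one does, since the conditions form a linear system with rational coefficients. -}

module Defs where

open import Data.Nat as ℕ using (ℕ; zero; suc)
open import Data.Bool using (Bool; false; true; if_then_else_)
open import Data.Fin as Fin using (Fin)
open import Data.Fin.Properties using (_≟_)
open import Data.Vec as V using (Vec; map; replicate)
import Data.Vec.Membership.DecPropositional as VMem
open import Data.List as L using (List; length)
open import Data.List.Relation.Unary.All using (All)
open import Data.List.Relation.Unary.Unique.Propositional using (Unique)
open import Data.Integer using (+_)
open import Data.Rational using (ℚ; 0ℚ; 1ℚ; _+_; _*_; _/_; _≤_)
open import Data.Product using (Σ; _×_)
open import Relation.Binary.PropositionalEquality using (_≡_; _≢_)
open import Relation.Nullary using (¬_; does)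

E : ℕ → Set
E q = Vec Bool q

-- A q-subset S of [p] = Fin p, represented by its elements listed in
-- strictly increasing order.
StrictlyIncreasing : ∀ {p q} → Vec (Fin p) q → Set
StrictlyIncreasing {p} {q} S = ∀ (a b : Fin q) → a Fin.< b → V.lookup S a Fin.< V.lookup S b

-- A family F ⊆ binom([p], q): a duplicate-free list of q-subsets.
-- (The order of the list fixes the coordinate order of proj_F.)
record Family (p q : ℕ) : Set where
  constructor family
  field
    sets     : List (Vec (Fin p) q)
    subsets  : All StrictlyIncreasing sets
    distinct : Unique sets

open Family public

arity : ∀ {p q} → Family p q → ℕ
arity F = length (sets F)

memb : ∀ {p q} (F : Family p q) → Fin (arity F) → Vec (Fin p) q
memb F j = L.lookup (sets F) j

restrict : ∀ {p q} → Vec Bool p → Vec (Fin p) q → E q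
restrict x S = map (V.lookup x) S

projF : ∀ {p q} (F : Family p q) → Vec Bool p → Fin (arity F) → E q
projF F x j = restrict x (memb F j)

OR-DP : ∀ {p q} (F : Family p q) → (Fin (arity F) → E q) → Set
OR-DP {p} F t = Σ (Vec Bool p) λ x → (x ≢ replicate p false) × (∀ j → t j ≡ projF F x j)

sumℚ : ∀ {m} → (Fin m → ℚ) → ℚ
sumℚ {zero}  w = 0ℚ
sumℚ {suc m} w = w Fin.zero + sumℚ (λ j → w (Fin.suc j))

contains : ∀ {p q} → Vec (Fin p) q → Fin p → Bool
contains S i = does (i ∈? S)
  where open VMem _≟_

-- F is q/p-regular: a probability distribution w on F such that each
-- i ∈ [p] lies in a w-random member of F with probability exactly q/p
-- (written p · Pr[i ∈ S] = q to avoid dividing by the variable p).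
Regular : ∀ {p q} → Family p q → Set
Regular {p} {q} F =
  Σ (Fin (arity F) → ℚ) λ w →
    (∀ j → 0ℚ ≤ w j) ×
    (sumℚ w ≡ 1ℚ) ×
    (∀ (i : Fin p) →
       (+ p / 1) * sumℚ (λ j → if contains (memb F j) i then w j else 0ℚ) ≡ + q / 1)

-- CSP(R) instances on X = Fin n for a relation R ⊆ D^r (given as predicate).
-- Clauses are r-tuples of variables; Y is a duplicate-free list of clauses.
Clause : ℕ → ℕ → Set
Clause n r = Vec (Fin n) r

Satisfies : ∀ {D : Set} {n r} → ((Fin r → D) → Set) → (Fin n → D) → Clause n r → Set
Satisfies R σ y = R (λ j → σ (V.lookup y j))

NonRedundant : ∀ {D : Set} {n r} → ((Fin r → D) → Set) → List (Clause n r) → Set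
NonRedundant {D} {n} R Y =
  Unique Y ×
  (∀ (i : Fin (length Y)) →
     Σ (Fin n → D) λ σ →
       (∀ (k : Fin (length Y)) → k ≢ i → Satisfies R σ (L.lookup Y k)) ×
       ¬ Satisfies R σ (L.lookup Y i))

{-# OPTIONS --safe #-}

-- Upper bound.  Let σ_y violate the clause y and satisfy the others.  Being the projection of some
-- x ∈ {0,1}^p is a system of equations between pairs of bits, and 0 is the only projection outside
-- OR-DP_F, so σ_y either breaks an equation at y or maps y to 0.  The broken equations are dual to
-- the σ_y, hence linearly independent over F₂, and at most n q clauses are of the first kind.  On
-- the clauses of the second kind all equations hold, so sending y to the rows
-- (σ_y'(y)_i)_{y'}, i ∈ [p], is well defined; it is injective since σ_y kills y alone, and for
-- S ∈ F its coordinates in S depend only on the variable y_S.  Shearer's inequality for F with the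
-- given distribution bounds the number of such clauses by n^{p/q}.
--
-- Lower bound.  For z ∈ [m]^p take the clause with variables (S , z|_S).  The assignment marking
-- the coordinates in which a variable disagrees with z sends the clause of z′ to the projection of
-- the vector ([z_i ≠ z′_i])_i, which vanishes exactly for z′ = z.

module Submission where

open import Defs
open import Data.Bool using (Bool; true; false; not; _∧_; _xor_; if_then_else_)
import Data.Bool.Properties as Bool
open import Data.Fin as Fin using (Fin; zero; suc; toℕ; fromℕ<; inject≤; combine; remQuot; funToFin; finToFun)
open import Data.Fin.Properties as Fin
  using (any?; injective⇒≤; remQuot-combine; toℕ-injective; toℕ-fromℕ<; toℕ-inject≤; toℕ<n;
         funToFin-finToFin; finToFun-funToFin; 2↔Bool)
import Data.Integer as ℤ
import Data.Integer.Properties as ℤ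
open import Data.List as L using (List; []; _∷_; _++_; length; filter; filterᵇ; concat; allFin)
open import Data.List.Membership.Propositional using (_∈_)
open import Data.List.Membership.Propositional.Properties using (∈-lookup; ∈-tabulate⁻)
open import Data.List.Properties using (length-map; length-++; length-tabulate; length-replicate; filter-++)
open import Data.List.Relation.Unary.All as All using (All; []; _∷_)
import Data.List.Relation.Unary.All.Properties as All
open import Data.List.Relation.Unary.AllPairs as AllPairs using (AllPairs; []; _∷_)
import Data.List.Relation.Unary.AllPairs.Properties as AllPairs
open import Data.List.Relation.Unary.Any using (here; there)
open import Data.List.Relation.Unary.Unique.Propositional using (Unique)
import Data.List.Relation.Unary.Unique.Propositional.Properties as Unique
open import Data.Nat
open import Data.Nat.ListAction using (sum; product)
open import Data.Nat.Properties
open import Data.Nat.Tactic.RingSolver using (solve-∀)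
open import Data.Product using (Σ; ∃; _×_; _,_; proj₁; proj₂)
open import Data.Rational as ℚ using (ℚ; mkℚ; 0ℚ; 1ℚ; toℚᵘ)
import Data.Rational.Properties as ℚ
open import Data.Rational.Unnormalised as ℚᵘ using (mkℚᵘ; *≡*)
import Data.Rational.Unnormalised.Properties as ℚᵘ
open import Data.Sum using (_⊎_; inj₁; inj₂; [_,_]′)
open import Data.Vec as V using (Vec; []; _∷_)
import Data.Vec.Membership.DecPropositional as VMem
open import Data.Vec.Properties using (tabulate-cong; tabulate∘lookup; lookup∘tabulate; lookup-map; lookup-replicate; ≡-dec)
import Data.Vec.Relation.Unary.Any as VAny
import Data.Vec.Relation.Unary.Any.Properties as VAny
open import Function using (_∘_; it; Inverse; Injective)
open import Relation.Binary.PropositionalEquality hiding ([_]; J)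
open import Relation.Nullary using (¬_; ¬?; yes; no; does; contradiction)
open import Relation.Nullary.Decidable using (decidable-stable; dec-true; _×-dec_)
open import Relation.Unary using (Decidable)

-- Superadditivity of the geometric mean

*-^-distrib : ∀ m n k → (m * n) ^ k ≡ m ^ k * n ^ k
*-^-distrib m n zero    = refl
*-^-distrib m n (suc k) rewrite *-^-distrib m n k = lem m n (m ^ k) (n ^ k)
  where
  lem : ∀ m n a b → m * n * (a * b) ≡ m * a * (n * b)
  lem = solve-∀

0^n≡0 : ∀ n .{{_ : NonZero n}} → 0 ^ n ≡ 0
0^n≡0 (suc n) = refl

^-cancelʳ-≤ : ∀ {m n} k .{{_ : NonZero k}} → m ^ k ≤ n ^ k → m ≤ n
^-cancelʳ-≤ k le = ≮⇒≥ (λ n<m → <⇒≱ (^-monoˡ-< k n<m) le)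

2uv≤u²+v² : ∀ u v → 2 * (u * v) ≤ u * u + v * v
2uv≤u²+v² u v = [ ordered , (λ v≤u → subst₂ _≤_ (cong (2 *_) (*-comm v u)) (+-comm (v * v) (u * u)) (ordered v≤u)) ]′
                (≤-total u v)
  where
  expand : ∀ u d → u * u + (u + d) * (u + d) ≡ 2 * (u * (u + d)) + d * d
  expand = solve-∀
  ordered : ∀ {u v} → u ≤ v → 2 * (u * v) ≤ u * u + v * v
  ordered {u} u≤v with d , refl ← m≤n⇒∃[o]m+o≡n u≤v =
    subst (2 * (u * (u + d)) ≤_) (sym (expand u d)) (m≤m+n _ _)

-- Young's inequality without division. In the induction step `2uv≤u²+v²` trades `u ^ suc t * v` for
-- `u ^ suc (suc t)` and `u ^ t * (v * v)`, and the induction hypothesis times `v` handles the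
-- latter. The term added on both sides and cancelled at the end replaces a subtraction.
young : ∀ t u v → suc t * (u ^ t * v) ≤ t * u ^ suc t + v ^ suc t
young zero    u v = ≤-reflexive (lem v)
  where
  lem : ∀ v → 1 * (1 * v) ≡ v * 1
  lem = solve-∀
young (suc t) u v = +-cancelʳ-≤ (t * (a * (u * v))) _ _ (begin
  suc (suc t) * (u * a * v) + t * (a * (u * v))  ≡⟨ lem₁ t u v a ⟩
  suc t * a * (2 * (u * v))                      ≤⟨ *-monoʳ-≤ (suc t * a) (2uv≤u²+v² u v) ⟩
  suc t * a * (u * u + v * v)                    ≡⟨ lem₂ t u v a ⟩
  suc t * (u * (u * a)) + suc t * (a * v) * v    ≤⟨ +-monoʳ-≤ (suc t * (u * (u * a))) (*-monoˡ-≤ v (young t u v)) ⟩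
  suc t * (u * (u * a)) + (t * (u * a) + v * b) * v ≡⟨ lem₃ t u v a b ⟩
  suc t * (u * (u * a)) + v * (v * b) + t * (a * (u * v)) ∎)
  where
  open ≤-Reasoning
  a = u ^ t
  b = v ^ t
  lem₁ : ∀ t u v a → suc (suc t) * (u * a * v) + t * (a * (u * v)) ≡ suc t * a * (2 * (u * v))
  lem₁ = solve-∀
  lem₂ : ∀ t u v a → suc t * a * (u * u + v * v) ≡ suc t * (u * (u * a)) + suc t * (a * v) * v
  lem₂ = solve-∀
  lem₃ : ∀ t u v a b → suc t * (u * (u * a)) + (t * (u * a) + v * b) * v
                     ≡ suc t * (u * (u * a)) + v * (v * b) + t * (a * (u * v))
  lem₃ = solve-∀

-- Maximises `s ^ t * b` for a fixed sum `s + b`. At the optimum `s = t * b` the two arguments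
-- `suc t * s` and `t * (s + b)` fed to `young` coincide.
weighted-amgm : ∀ t s b → suc t ^ suc t * (s ^ t * b) ≤ t ^ t * (s + b) ^ suc t
weighted-amgm zero s b = begin
  1 * (1 * b)        ≡⟨ lem b ⟩
  1 * (b * 1)        ≤⟨ *-monoʳ-≤ 1 (*-monoˡ-≤ 1 (m≤n+m b s)) ⟩
  1 * ((s + b) * 1)  ∎
  where
  open ≤-Reasoning
  lem : ∀ b → 1 * (1 * b) ≡ 1 * (b * 1)
  lem = solve-∀
weighted-amgm t@(suc t′) s b =
  *-cancelˡ-≤ t (+-cancelˡ-≤ (t * (suc t * T * (s * σ))) _ _ (begin
    t * (suc t * T * (s * σ)) + t * (suc t * T * (σ * b))  ≡⟨ lem₁ t T s σ b ⟩
    suc t * (T * σ * (t * (s + b)))                        ≡⟨ cong (λ r → suc t * (r * (t * (s + b)))) (*-^-distrib (suc t) s t) ⟨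
    suc t * ((suc t * s) ^ t * (t * (s + b)))              ≤⟨ young t (suc t * s) (t * (s + b)) ⟩
    t * (suc t * s) ^ suc t + (t * (s + b)) ^ suc t        ≡⟨ cong₂ (λ x y → t * x + y) (*-^-distrib (suc t) s (suc t)) (*-^-distrib t (s + b) (suc t)) ⟩
    t * (suc t * T * (s * σ)) + t * t ^ t * (s + b) ^ suc t ≡⟨ cong (t * (suc t * T * (s * σ)) +_) (*-assoc t (t ^ t) _) ⟩
    t * (suc t * T * (s * σ)) + t * (t ^ t * (s + b) ^ suc t) ∎))
  where
  open ≤-Reasoning
  T = suc t ^ t
  σ = s ^ t
  lem₁ : ∀ t T s σ b → t * (suc t * T * (s * σ)) + t * (suc t * T * (σ * b)) ≡ suc t * (T * σ * (t * (s + b)))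
  lem₁ = solve-∀

-- AM-GM with denominators cleared. `weighted-amgm` joins the new entry to the sum of the others;
-- cancelling `t ^ t` is legitimate for `t = 0` too, because `0 ^ 0` is 1.
amgm : ∀ as → length as ^ length as * product as ≤ sum as ^ length as
amgm []       = ≤-refl
amgm (a ∷ as) = *-cancelˡ-≤ (t ^ t) {{t^t≢0 t}} (begin
  t ^ t * (suc t ^ suc t * (a * product as))  ≡⟨ lem (t ^ t) (suc t ^ suc t) a (product as) ⟩
  suc t ^ suc t * (t ^ t * product as * a)    ≤⟨ *-monoʳ-≤ (suc t ^ suc t) (*-monoˡ-≤ a (amgm as)) ⟩
  suc t ^ suc t * (sum as ^ t * a)            ≤⟨ weighted-amgm t (sum as) a ⟩
  t ^ t * (sum as + a) ^ suc t                ≡⟨ cong (λ s → t ^ t * s ^ suc t) (+-comm (sum as) a) ⟩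
  t ^ t * (a + sum as) ^ suc t                ∎)
  where
  open ≤-Reasoning
  t = length as
  t^t≢0 : ∀ t → NonZero (t ^ t)
  t^t≢0 zero    = _
  t^t≢0 (suc t) = m^n≢0 (suc t) (suc t)
  lem : ∀ w z a p → w * (z * (a * p)) ≡ z * (w * p * a)
  lem = solve-∀

-- The mediant (X + X′) / (A + A′) lies below the larger of X / A and X′ / A′,
-- which replaces comparing both ratios with the t-th root of K.
mediant : ∀ t .{{_ : NonZero t}} K A A′ X X′ →
          X ^ t ≤ K * A ^ t → X′ ^ t ≤ K * A′ ^ t → (X + X′) ^ t ≤ K * (A + A′) ^ t
mediant t K A A′ X X′ h h′ =
  [ ordered A A′ X X′ h h′
  , (λ le → subst₂ (λ x a → x ^ t ≤ K * a ^ t) (+-comm X′ X) (+-comm A′ A) (ordered A′ A X′ X h′ h le)) ]′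
  (≤-total (A * X′) (A′ * X))
  where
  open ≤-Reasoning
  lem₁ : ∀ A A′ X → A * X + A′ * X ≡ (A + A′) * X
  lem₁ = solve-∀
  lem₂ : ∀ a k b → a * (k * b) ≡ b * (k * a)
  lem₂ = solve-∀
  ordered : ∀ A A′ X X′ → X ^ t ≤ K * A ^ t → X′ ^ t ≤ K * A′ ^ t → A * X′ ≤ A′ * X →
            (X + X′) ^ t ≤ K * (A + A′) ^ t
  ordered zero A′ X X′ h h′ le = subst (λ x → (x + X′) ^ t ≤ K * A′ ^ t) (sym X≡0) h′
    where
    X≡0 : X ≡ 0
    X≡0 = m^n≡0⇒m≡0 X t (n≤0⇒n≡0 (subst (X ^ t ≤_) (trans (cong (K *_) (0^n≡0 t)) (*-zeroʳ K)) h))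
  ordered A@(suc _) A′ X X′ h h′ le = *-cancelˡ-≤ (A ^ t) {{m^n≢0 A t}} (begin
    A ^ t * (X + X′) ^ t        ≡⟨ *-^-distrib A (X + X′) t ⟨
    (A * (X + X′)) ^ t          ≡⟨ cong (_^ t) (*-distribˡ-+ A X X′) ⟩
    (A * X + A * X′) ^ t        ≤⟨ ^-monoˡ-≤ t (+-monoʳ-≤ (A * X) le) ⟩
    (A * X + A′ * X) ^ t        ≡⟨ cong (_^ t) (lem₁ A A′ X) ⟩
    ((A + A′) * X) ^ t          ≡⟨ *-^-distrib (A + A′) X t ⟩
    (A + A′) ^ t * X ^ t        ≤⟨ *-monoʳ-≤ ((A + A′) ^ t) h ⟩
    (A + A′) ^ t * (K * A ^ t)  ≡⟨ lem₂ ((A + A′) ^ t) K (A ^ t) ⟩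
    A ^ t * (K * (A + A′) ^ t)  ∎)

prod : ∀ {I : Set} → List I → (I → ℕ) → ℕ
prod J y = product (L.map y J)

prod-mono : ∀ {I : Set} (J : List I) {y z : I → ℕ} → (∀ j → y j ≤ z j) → prod J y ≤ prod J z
prod-mono []      h = ≤-refl
prod-mono (j ∷ J) h = *-mono-≤ (h j) (prod-mono J h)

-- The list of the numbers y j · ∏_{i ≠ j} s i, that is of P · (y j / s j) for P = ∏ s.
cofactors : ∀ {I : Set} → List I → (s y : I → ℕ) → List ℕ
cofactors []      s y = []
cofactors (j ∷ J) s y = y j * prod J s ∷ L.map (s j *_) (cofactors J s y)

length-cofactors : ∀ {I : Set} (J : List I) s y → length (cofactors J s y) ≡ length J
length-cofactors []      s y = refl
length-cofactors (j ∷ J) s y =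
  cong suc (trans (length-map (s j *_) (cofactors J s y)) (length-cofactors J s y))

sum-map-* : ∀ c as → sum (L.map (c *_) as) ≡ c * sum as
sum-map-* c []       = sym (*-zeroʳ c)
sum-map-* c (a ∷ as) = trans (cong (c * a +_) (sum-map-* c as)) (sym (*-distribˡ-+ c a (sum as)))

product-map-* : ∀ c as → product (L.map (c *_) as) ≡ c ^ length as * product as
product-map-* c []       = refl
product-map-* c (a ∷ as) rewrite product-map-* c as = lem c a (c ^ length as) (product as)
  where
  lem : ∀ c a e p → c * a * (e * p) ≡ c * e * (a * p)
  lem = solve-∀

-- The two cofactors at each j add up to s j · ∏_{i ≠ j} s i, the full product, so every j
-- contributes the same amount.
sum-cofactors : ∀ {I : Set} (J : List I) (y z : I → ℕ) → let s = λ j → y j + z j in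
                sum (cofactors J s y) + sum (cofactors J s z) ≡ length J * prod J s
sum-cofactors []      y z = refl
sum-cofactors (j ∷ J) y z = begin-equality
  y j * P + sum (L.map (s j *_) (cofactors J s y)) + (z j * P + sum (L.map (s j *_) (cofactors J s z)))
    ≡⟨ cong₂ (λ a b → y j * P + a + (z j * P + b)) (sum-map-* (s j) (cofactors J s y)) (sum-map-* (s j) (cofactors J s z)) ⟩
  y j * P + s j * A + (z j * P + s j * B)
    ≡⟨ lem₁ (y j) (z j) P A B ⟩
  s j * P + s j * (A + B)
    ≡⟨ cong (λ r → s j * P + s j * r) (sum-cofactors J y z) ⟩
  s j * P + s j * (length J * P)
    ≡⟨ lem₂ (s j) P (length J) ⟩
  suc (length J) * (s j * P) ∎
  where
  open ≤-Reasoning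
  s = λ j → y j + z j
  P = prod J s
  A = sum (cofactors J s y)
  B = sum (cofactors J s z)
  lem₁ : ∀ y z P A B → y * P + (y + z) * A + (z * P + (y + z) * B) ≡ (y + z) * P + (y + z) * (A + B)
  lem₁ = solve-∀
  lem₂ : ∀ s P l → s * P + s * (l * P) ≡ suc l * (s * P)
  lem₂ = solve-∀

-- Up to division, the cofactor at j is y j · P / s j with P = `prod J s`, and the denominators
-- multiply to P. The factor `prod J s` on the left clears them.
product-cofactors : ∀ {I : Set} (J : List I) s y →
                    product (cofactors J s y) * prod J s ≡ prod J y * prod J s ^ length J
product-cofactors []      s y = refl
product-cofactors (j ∷ J) s y = begin-equality
  y j * P * product (L.map (s j *_) cs) * (s j * P)
    ≡⟨ cong (λ r → y j * P * r * (s j * P))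
            (trans (product-map-* (s j) cs) (cong (λ l → s j ^ l * product cs) (length-cofactors J s y))) ⟩
  y j * P * (s j ^ t * product cs) * (s j * P)
    ≡⟨ lem₁ (y j) P (s j) (s j ^ t) (product cs) ⟩
  y j * (s j * (s j ^ t)) * P * (product cs * P)
    ≡⟨ cong (y j * (s j * (s j ^ t)) * P *_) (product-cofactors J s y) ⟩
  y j * (s j * (s j ^ t)) * P * (Y * P ^ t)
    ≡⟨ lem₂ (y j) P (s j) (s j ^ t) Y (P ^ t) ⟩
  y j * Y * (s j * P * (s j ^ t * P ^ t))
    ≡⟨ cong (λ r → y j * Y * (s j * P * r)) (*-^-distrib (s j) P t) ⟨
  y j * Y * (s j * P * (s j * P) ^ t) ∎
  where
  open ≤-Reasoning
  t = length J
  P = prod J s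
  Y = prod J y
  cs = cofactors J s y
  lem₁ : ∀ y P s e c → y * P * (e * c) * (s * P) ≡ y * (s * e) * P * (c * P)
  lem₁ = solve-∀
  lem₂ : ∀ y P s e Y Q → y * (s * e) * P * (Y * Q) ≡ y * Y * (s * P * (e * Q))
  lem₂ = solve-∀

-- AM-GM is applied to the ratios y j / (y j + z j) and
-- z j / (y j + z j), whose two sums add up to t.
mahler : ∀ {I : Set} (J : List I) (y z : I → ℕ) C u v t .{{_ : NonZero t}} → length J ≡ t →
         u ^ t ≤ C * prod J y → v ^ t ≤ C * prod J z → (u + v) ^ t ≤ C * prod J (λ j → y j + z j)
mahler {I} J y z C u v t refl hu hv with prod J (λ j → y j + z j) in eqP
-- A vanishing product leaves nothing to divide by; but it dominates the products of `y` and of `z`,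
-- so `u` and `v` are both 0.
... | zero = ≤-reflexive (trans (cong (_^ t) (cong₂ _+_ (vanish u y hu (λ j → m≤m+n (y j) (z j)))
                                                        (vanish v z hv (λ j → m≤n+m (z j) (y j)))))
                                (trans (0^n≡0 t) (sym (*-zeroʳ C))))
  where
  open ≤-Reasoning
  vanish : ∀ u (y′ : I → ℕ) → u ^ t ≤ C * prod J y′ → (∀ j → y′ j ≤ y j + z j) → u ≡ 0
  vanish u y′ h le = m^n≡0⇒m≡0 u t (n≤0⇒n≡0 (begin
    u ^ t                        ≤⟨ h ⟩
    C * prod J y′                ≤⟨ *-monoʳ-≤ C (prod-mono J le) ⟩
    C * prod J (λ j → y j + z j) ≡⟨ cong (C *_) eqP ⟩
    C * 0                        ≡⟨ *-zeroʳ C ⟩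
    0                            ∎))
... | P@(suc _) = *-cancelʳ-≤ _ _ ((t * P) ^ t) {{m^n≢0 (t * P) t {{m*n≢0 t P}}}} (begin
    (u + v) ^ t * (t * P) ^ t   ≡⟨ *-^-distrib (u + v) (t * P) t ⟨
    ((u + v) * (t * P)) ^ t     ≡⟨ cong (_^ t) (*-distribʳ-+ (t * P) u v) ⟩
    (u * (t * P) + v * (t * P)) ^ t ≤⟨ mediant t (C * P) (A y) (A z) _ _ (ratio u y hu) (ratio v z hv) ⟩
    C * P * (A y + A z) ^ t     ≡⟨ cong (λ r → C * P * r ^ t) (trans (sum-cofactors J y z) (cong (t *_) eqP)) ⟩
    C * P * (t * P) ^ t         ∎)
  where
  open ≤-Reasoning
  s = λ j → y j + z j
  A : (I → ℕ) → ℕ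
  A y = sum (cofactors J s y)
  lem₁ : ∀ C Y w T → C * Y * (T * w) ≡ C * (T * (Y * w))
  lem₁ = solve-∀
  lem₂ : ∀ C T c P → C * (T * (c * P)) ≡ C * P * (T * c)
  lem₂ = solve-∀
  ratio : ∀ u y → u ^ t ≤ C * prod J y → (u * (t * P)) ^ t ≤ C * P * A y ^ t
  ratio u y h = begin
    (u * (t * P)) ^ t                 ≡⟨ *-^-distrib u (t * P) t ⟩
    u ^ t * (t * P) ^ t               ≤⟨ *-monoˡ-≤ ((t * P) ^ t) h ⟩
    C * prod J y * (t * P) ^ t        ≡⟨ cong (C * prod J y *_) (*-^-distrib t P t) ⟩
    C * prod J y * (t ^ t * P ^ t)    ≡⟨ lem₁ C (prod J y) (P ^ t) (t ^ t) ⟩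
    C * (t ^ t * (prod J y * P ^ t))  ≡⟨ cong (λ r → C * (t ^ t * r)) (subst (λ P → product cs * P ≡ prod J y * P ^ t) eqP (product-cofactors J s y)) ⟨
    C * (t ^ t * (product cs * P))    ≡⟨ lem₂ C (t ^ t) (product cs) P ⟩
    C * P * (t ^ t * product cs)      ≤⟨ *-monoʳ-≤ (C * P) (subst (λ l → l ^ l * product cs ≤ A y ^ l) (length-cofactors J s y) (amgm cs)) ⟩
    C * P * A y ^ t                   ∎
    where cs = cofactors J s y

-- Shearer's inequality

prod-if : ∀ {I : Set} (b : I → Bool) (J : List I) (d c : I → ℕ) →
          prod J (λ j → if b j then d j else c j) ≡ prod (filterᵇ (not ∘ b) J) c * prod (filterᵇ b J) d
prod-if b []      d c = refl
prod-if b (j ∷ J) d c with b j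
... | true  = trans (cong (d j *_) (prod-if b J d c)) (lem (d j) (prod (filterᵇ (not ∘ b) J) c) _)
  where
  lem : ∀ x p q → x * (p * q) ≡ p * (x * q)
  lem = solve-∀
... | false = trans (cong (c j *_) (prod-if b J d c)) (sym (*-assoc (c j) _ _))

-- Shearer's inequality is a Hölder inequality in each coordinate: members containing the coordinate
-- contribute a sum over its values, the remaining members a maximum.
op : Bool → ℕ → ℕ → ℕ
op b m n = if b then m + n else m ⊔ n

-- Where `b j` is false, `y j` and `z j` are both enlarged to their maximum, so these members give a
-- common factor `C`. The remaining members are `t` in number, exactly what `mahler` needs for the
-- exponent `t`.
holder-op : ∀ {I : Set} (b : I → Bool) (J : List I) (y z : I → ℕ) u v t .{{_ : NonZero t}} →
            length (filterᵇ b J) ≡ t → u ^ t ≤ prod J y → v ^ t ≤ prod J z →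
            (u + v) ^ t ≤ prod J (λ j → op (b j) (y j) (z j))
holder-op {I} b J y z u v t count hu hv = subst ((u + v) ^ t ≤_) (sym (prod-if b J (λ j → y j + z j) m))
  (mahler (filterᵇ b J) y z C u v t count
          (factor u y hu (λ j → m≤m⊔n (y j) (z j)))
          (factor v z hv (λ j → m≤n⊔m (y j) (z j))))
  where
  m : I → ℕ
  m j = y j ⊔ z j
  C = prod (filterᵇ (not ∘ b) J) m
  factor : ∀ u w → u ^ t ≤ prod J w → (∀ j → w j ≤ m j) → u ^ t ≤ C * prod (filterᵇ b J) w
  factor u w h le = begin
    u ^ t                                        ≤⟨ h ⟩
    prod J w                                     ≤⟨ prod-mono J below ⟩
    prod J (λ j → if b j then w j else m j)      ≡⟨ prod-if b J w m ⟩
    C * prod (filterᵇ b J) w                     ∎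
    where
    open ≤-Reasoning
    below : ∀ j → w j ≤ (if b j then w j else m j)
    below j with b j
    ... | true  = ≤-refl
    ... | false = le j

fold : Bool → ∀ {M} → (Fin M → ℕ) → ℕ
fold b {zero}  g = 0
fold b {suc M} g = op b (g zero) (fold b (g ∘ suc))

holder-fold : ∀ {I : Set} (b : I → Bool) (J : List I) t .{{_ : NonZero t}} → length (filterᵇ b J) ≡ t →
              ∀ {M} (x : Fin M → ℕ) (y : I → Fin M → ℕ) →
              (∀ a → x a ^ t ≤ prod J (λ j → y j a)) →
              fold true x ^ t ≤ prod J (λ j → fold (b j) (y j))
holder-fold b J t count {zero}  x y h = subst (_≤ prod J (λ _ → 0)) (sym (0^n≡0 t)) z≤n
holder-fold b J t count {suc M} x y h =
  holder-op b J (λ j → y j zero) (λ j → fold (b j) (y j ∘ suc)) (x zero) (fold true (x ∘ suc)) t count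
    (h zero) (holder-fold b J t count (x ∘ suc) (λ j → y j ∘ suc) (h ∘ suc))

-- For the indicator f of a set Z, at most the number of points of the projection of Z to the
-- coordinates selected by S, and equal to |Z| when S selects everything.
norm : ∀ {p M} → (Fin p → Bool) → (Vec (Fin M) p → ℕ) → ℕ
norm {zero}  S f = f []
norm {suc p} S f = fold (S zero) (λ a → norm (S ∘ suc) (λ v → f (a ∷ v)))

total : ∀ {p M} → (Vec (Fin M) p → ℕ) → ℕ
total = norm (λ _ → true)

-- Induction on the coordinates: the slices of `f` at a fixed first value `a` satisfy the claim for
-- the remaining coordinates, and `holder-fold` assembles them over `a`. The pointwise hypothesis on
-- `f` is the case of no coordinates.
shearer : ∀ {I : Set} {p M} (J : List I) (S : I → Fin p → Bool) t .{{_ : NonZero t}} →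
          (∀ i → length (filterᵇ (λ j → S j i) J) ≡ t) →
          (f : Vec (Fin M) p → ℕ) → (∀ v → f v ^ t ≤ prod J (λ _ → f v)) →
          total f ^ t ≤ prod J (λ j → norm (S j) f)
shearer {p = zero}  J S t cover f h = h []
shearer {p = suc p} J S t cover f h =
  holder-fold (λ j → S j zero) J t (cover zero) _ _
    (λ a → shearer J (λ j → S j ∘ suc) t (cover ∘ suc) (λ v → f (a ∷ v)) (λ v → h (a ∷ v)))

-- Indicator functions and the sizes of projections

fold-cong : ∀ b {M} {g h : Fin M → ℕ} → (∀ a → g a ≡ h a) → fold b g ≡ fold b h
fold-cong b {zero}  eq = refl
fold-cong b {suc M} eq = cong₂ (op b) (eq zero) (fold-cong b (eq ∘ suc))

fold-+ : ∀ {M} (g h : Fin M → ℕ) → fold true (λ a → g a + h a) ≡ fold true g + fold true h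
fold-+ {zero}  g h = refl
fold-+ {suc M} g h = trans (cong (g zero + h zero +_) (fold-+ (g ∘ suc) (h ∘ suc)))
                           (lem (g zero) (h zero) _ (fold true (h ∘ suc)))
  where
  lem : ∀ a b c d → a + b + (c + d) ≡ a + c + (b + d)
  lem = solve-∀

fold-0 : ∀ M → fold true {M} (λ _ → 0) ≡ 0
fold-0 zero    = refl
fold-0 (suc M) = fold-0 M

fold-single : ∀ {M} (b : Fin M) x → fold true (λ a → if does (b Fin.≟ a) then x else 0) ≡ x
fold-single {suc M} zero    x = trans (cong (x +_) (fold-0 M)) (+-identityʳ x)
fold-single {suc M} (suc b) x = fold-single b x

norm-cong : ∀ {p M} (S : Fin p → Bool) {f g : Vec (Fin M) p → ℕ} → (∀ v → f v ≡ g v) → norm S f ≡ norm S g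
norm-cong {zero}  S eq = eq []
norm-cong {suc p} S eq = fold-cong (S zero) (λ a → norm-cong (S ∘ suc) (λ v → eq (a ∷ v)))

total-0 : ∀ p {M} → total {p} {M} (λ _ → 0) ≡ 0
total-0 zero        = refl
total-0 (suc p) {M} = trans (fold-cong true {M} (λ _ → total-0 p {M})) (fold-0 M)

total-+ : ∀ {p M} (f g : Vec (Fin M) p → ℕ) → total (λ v → f v + g v) ≡ total f + total g
total-+ {zero}  f g = refl
total-+ {suc p} f g = trans (fold-cong true (λ a → total-+ (f ∘ (a ∷_)) (g ∘ (a ∷_))))
                            (fold-+ (λ a → total (f ∘ (a ∷_))) (λ a → total (g ∘ (a ∷_))))

δ : ∀ {p M} → Vec (Fin M) p → Vec (Fin M) p → ℕ
δ []      []      = 1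
δ (b ∷ w) (a ∷ v) = if does (b Fin.≟ a) then δ w v else 0

total-δ : ∀ {p M} (w : Vec (Fin M) p) → total (δ w) ≡ 1
total-δ []      = refl
total-δ {suc p} (b ∷ w) = trans (fold-cong true slice) (fold-single b 1)
  where
  slice : ∀ a → total (λ v → δ (b ∷ w) (a ∷ v)) ≡ (if does (b Fin.≟ a) then 1 else 0)
  slice a with does (b Fin.≟ a)
  ... | true  = total-δ w
  ... | false = total-0 p

δ≤1 : ∀ {p M} (w v : Vec (Fin M) p) → δ w v ≤ 1
δ≤1 []      []      = ≤-refl
δ≤1 (b ∷ w) (a ∷ v) with does (b Fin.≟ a)
... | true  = δ≤1 w v
... | false = z≤n

δ>0⇒≡ : ∀ {p M} (w v : Vec (Fin M) p) → 0 < δ w v → w ≡ v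
δ>0⇒≡ []      []      _ = refl
δ>0⇒≡ (b ∷ w) (a ∷ v) h with b Fin.≟ a
... | yes refl = cong (b ∷_) (δ>0⇒≡ w v h)

-- For a duplicate-free list this is the 0-1 indicator function to which `shearer` gets applied.
multiplicity : ∀ {p M} → List (Vec (Fin M) p) → Vec (Fin M) p → ℕ
multiplicity []       v = 0
multiplicity (w ∷ ws) v = δ w v + multiplicity ws v

total-multiplicity : ∀ {p M} (ws : List (Vec (Fin M) p)) → total (multiplicity ws) ≡ length ws
total-multiplicity {p} [] = total-0 p
total-multiplicity (w ∷ ws) =
  trans (total-+ (δ w) (multiplicity ws)) (cong₂ _+_ (total-δ w) (total-multiplicity ws))

multiplicity>0⇒∈ : ∀ {p M} (ws : List (Vec (Fin M) p)) v → 0 < multiplicity ws v → v ∈ ws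
multiplicity>0⇒∈ (w ∷ ws) v h with δ w v in eq
... | zero  = there (multiplicity>0⇒∈ ws v h)
... | suc _ = here (sym (δ>0⇒≡ w v (subst (0 <_) (sym eq) z<s)))

multiplicity≤1 : ∀ {p M} {ws : List (Vec (Fin M) p)} → Unique ws → ∀ v → multiplicity ws v ≤ 1
multiplicity≤1 [] v = z≤n
multiplicity≤1 {ws = w ∷ ws} u@(_ ∷ us) v with multiplicity ws v in eq
... | zero  = subst (_≤ 1) (sym (+-identityʳ (δ w v))) (δ≤1 w v)
... | suc m with δ w v in eqδ
...   | zero  = subst (_≤ 1) eq (multiplicity≤1 us v)
...   | suc _ = contradiction (subst (_∈ ws) (sym w≡v) v∈ws) (Unique.Unique[x∷xs]⇒x∉xs u)
  where
  w≡v : w ≡ v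
  w≡v = δ>0⇒≡ w v (subst (0 <_) (sym eqδ) z<s)
  v∈ws : v ∈ ws
  v∈ws = multiplicity>0⇒∈ ws v (subst (0 <_) (sym eq) z<s)

DifferOn : ∀ {p M} → (Fin p → Bool) → Vec (Fin M) p → Vec (Fin M) p → Set
DifferOn S v w = ∃ λ i → S i ≡ true × V.lookup v i ≢ V.lookup w i

fold-max-attained : ∀ {M} (g : Fin M → ℕ) → fold false g ≡ 0 ⊎ ∃ λ a → fold false g ≡ g a
fold-max-attained {zero}  g = inj₁ refl
fold-max-attained {suc M} g with ⊔-sel (g zero) (fold false (g ∘ suc)) | fold-max-attained (g ∘ suc)
... | inj₁ eq | _              = inj₂ (zero , eq)
... | inj₂ eq | inj₁ eq′       = inj₁ (trans eq eq′)
... | inj₂ eq | inj₂ (a , eq′) = inj₂ (suc a , trans eq eq′)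

length-concat-tabulate : ∀ {A : Set} {M} (g : Fin M → List A) →
                         length (concat (L.tabulate g)) ≡ fold true (length ∘ g)
length-concat-tabulate {M = zero}  g = refl
length-concat-tabulate {M = suc M} g =
  trans (length-++ (g zero)) (cong (length (g zero) +_) (length-concat-tabulate (g ∘ suc)))

-- Realises `norm` by actual points: at a selected coordinate the witnesses of all slices are kept,
-- at any other coordinate only those of one slice where the maximum is attained.
norm-witness : ∀ {p M} (S : Fin p → Bool) (f : Vec (Fin M) p → ℕ) → (∀ v → f v ≤ 1) →
               ∃ λ vs → length vs ≡ norm S f × All (λ v → 0 < f v) vs × AllPairs (DifferOn S) vs
norm-witness {zero} S f f≤1 with f [] in eq | f≤1 []
... | zero        | _ = [] , refl , [] , []
... | suc zero    | _ = [] ∷ [] , refl , subst (0 <_) (sym eq) z<s ∷ [] , [] ∷ []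
... | suc (suc _) | s≤s ()
norm-witness {suc p} {M} S f f≤1 with S zero in eq
... | true  = concat (L.tabulate ext) , len
            , All.concat⁺ (All.tabulate⁺ positive)
            , AllPairs.concat⁺ (All.tabulate⁺ within) (AllPairs.tabulate⁺ across)
  where
  rec = λ a → norm-witness (S ∘ suc) (λ v → f (a ∷ v)) (λ v → f≤1 (a ∷ v))
  ext : Fin M → List (Vec (Fin M) (suc p))
  ext a = L.map (a ∷_) (proj₁ (rec a))
  len : length (concat (L.tabulate ext)) ≡ fold true (λ a → norm (S ∘ suc) (λ v → f (a ∷ v)))
  len = trans (length-concat-tabulate ext)
              (fold-cong true (λ a → trans (length-map (a ∷_) (proj₁ (rec a))) (proj₁ (proj₂ (rec a)))))
  positive : ∀ a → All (λ v → 0 < f v) (ext a)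
  positive a = All.map⁺ (proj₁ (proj₂ (proj₂ (rec a))))
  within : ∀ a → AllPairs (DifferOn S) (ext a)
  within a = AllPairs.map⁺ (AllPairs.map (λ { (i , Si , neq) → suc i , Si , neq }) (proj₂ (proj₂ (proj₂ (rec a)))))
  across : ∀ {a b} → a ≢ b → All (λ v → All (DifferOn S v) (ext b)) (ext a)
  across a≢b = All.map⁺ (All.universal (λ _ → All.map⁺ (All.universal (λ _ → zero , eq , a≢b) _)) _)
... | false with fold-max-attained (λ a → norm (S ∘ suc) (λ v → f (a ∷ v)))
...   | inj₁ eq0       = [] , sym eq0 , [] , []
...   | inj₂ (a , eqa) with vs , len , pos , diff ← norm-witness (S ∘ suc) (λ v → f (a ∷ v)) (λ v → f≤1 (a ∷ v)) =
  L.map (a ∷_) vs , trans (length-map (a ∷_) vs) (trans len (sym eqa)) , All.map⁺ pos ,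
  AllPairs.map⁺ (AllPairs.map (λ { (i , Si , neq) → suc i , Si , neq }) diff)

lookup-injective : ∀ {A : Set} {xs : List A} → Unique xs → ∀ {i j} → L.lookup xs i ≡ L.lookup xs j → i ≡ j
lookup-injective (_ ∷ _)  {zero}  {zero}  _  = refl
lookup-injective (h ∷ _)  {zero}  {suc j} eq = contradiction eq (All.lookup h (∈-lookup j))
lookup-injective (h ∷ _)  {suc i} {zero}  eq = contradiction (sym eq) (All.lookup h (∈-lookup i))
lookup-injective (_ ∷ us) {suc i} {suc j} eq = cong suc (lookup-injective us eq)

unique-length : ∀ {n} {xs : List (Fin n)} → Unique xs → length xs ≤ n
unique-length u = injective⇒≤ (lookup-injective u)

-- Points of the support with the same label agree on `S`, so the points supplied by `norm-witness`
-- carry distinct labels in `Fin n`.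
norm-bound : ∀ {p M n} (S : Fin p → Bool) (f : Vec (Fin M) p → ℕ) → (∀ v → f v ≤ 1) →
             (φ : ∀ v → 0 < f v → Fin n) →
             (∀ {v w} fv fw → φ v fv ≡ φ w fw → ∀ i → S i ≡ true → V.lookup v i ≡ V.lookup w i) →
             norm S f ≤ n
norm-bound {n = n} S f f≤1 φ det with vs , len , pos , diff ← norm-witness S f f≤1 =
  subst (_≤ n) (trans (length-reduce pos) len) (unique-length (reduce-unique pos diff))
  where
  image : ∀ {vs} → All (λ v → 0 < f v) vs → List (Fin n)
  image = All.reduce (λ {v} → φ v)
  length-reduce : ∀ {vs} (pos : All (λ v → 0 < f v) vs) → length (image pos) ≡ length vs
  length-reduce []        = refl
  length-reduce (_ ∷ pos) = cong suc (length-reduce pos)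
  head-fresh : ∀ {v vs} fv (pos : All (λ v → 0 < f v) vs) → All (DifferOn S v) vs → All (φ v fv ≢_) (image pos)
  head-fresh fv []         []                     = []
  head-fresh fv (fw ∷ pos) ((i , Si , neq) ∷ ds) = (λ eq → neq (det fv fw eq i Si)) ∷ head-fresh fv pos ds
  reduce-unique : ∀ {vs} (pos : All (λ v → 0 < f v) vs) → AllPairs (DifferOn S) vs → Unique (image pos)
  reduce-unique []         []        = []
  reduce-unique (fv ∷ pos) (d ∷ ds) = head-fresh fv pos d ∷ reduce-unique pos ds

prod-const : ∀ {I : Set} (J : List I) x → prod J (λ _ → x) ≡ x ^ length J
prod-const []      x = refl
prod-const (_ ∷ J) x = cong (x *_) (prod-const J x)

-- The counting form of Shearer's inequality: the label `h j l` determines the coordinates of `z l`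
-- in member `j`. The indicator of the points has total `N`, and by the labels each of its norms is
-- at most `n`.
shearer-count : ∀ {I : Set} {N p M n} (J : List I) (S : I → Fin p → Bool) t .{{_ : NonZero t}} →
                (∀ i → length (filterᵇ (λ j → S j i) J) ≡ t) →
                (z : Fin N → Vec (Fin M) p) → (∀ {l l′} → z l ≡ z l′ → l ≡ l′) →
                (h : I → Fin N → Fin n) →
                (∀ j {l l′} → h j l ≡ h j l′ → ∀ i → S j i ≡ true → V.lookup (z l) i ≡ V.lookup (z l′) i) →
                N ^ t ≤ n ^ length J
shearer-count {N = N} {n = n} J S t cover z z-inj h det = begin
  N ^ t                        ≡⟨ cong (_^ t) (trans (total-multiplicity (L.tabulate z)) (length-tabulate z)) ⟨
  total f ^ t                  ≤⟨ shearer J S t cover f (λ v → idempotent (f≤1 v)) ⟩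
  prod J (λ j → norm (S j) f)  ≤⟨ prod-mono J (λ j → norm-bound (S j) f f≤1 (λ v fv → h j (proj₁ (preimage fv))) (determined j)) ⟩
  prod J (λ _ → n)             ≡⟨ prod-const J n ⟩
  n ^ length J                 ∎
  where
  open ≤-Reasoning
  f = multiplicity (L.tabulate z)
  f≤1 : ∀ v → f v ≤ 1
  f≤1 = multiplicity≤1 (Unique.tabulate⁺ z-inj)
  preimage : ∀ {v} → 0 < f v → ∃ λ l → v ≡ z l
  preimage {v} fv = ∈-tabulate⁻ (multiplicity>0⇒∈ (L.tabulate z) v fv)
  determined : ∀ j {v w} (fv : 0 < f v) (fw : 0 < f w) → h j (proj₁ (preimage fv)) ≡ h j (proj₁ (preimage fw)) →
               ∀ i → S j i ≡ true → V.lookup v i ≡ V.lookup w i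
  determined j fv fw eq i Si with preimage fv | preimage fw
  ... | l , refl | l′ , refl = det j eq i Si
  -- At the value 0 this uses that `t` is nonzero; at the value 1 both sides are 1.
  idempotent : ∀ {x} → x ≤ 1 → x ^ t ≤ prod J (λ _ → x)
  idempotent {zero}        _ = subst (_≤ prod J (λ _ → 0)) (sym (0^n≡0 t)) z≤n
  idempotent {suc zero}    _ = ≤-reflexive (trans (^-zeroˡ t) (sym (trans (prod-const J 1) (^-zeroˡ (length J)))))
  idempotent {suc (suc _)} (s≤s ())

-- Uniform covers from rational distributions

ι : ℕ → ℚ
ι k = ℤ.+ k ℚ./ 1

toℚᵘ-ι : ∀ k → toℚᵘ (ι k) ℚᵘ.≃ mkℚᵘ (ℤ.+ k) 0
toℚᵘ-ι k = ℚ.toℚᵘ-fromℚᵘ (mkℚᵘ (ℤ.+ k) 0)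

ι-injective : ∀ {a b} → ι a ≡ ι b → a ≡ b
ι-injective {a} {b} eq with ℚᵘ.≃-trans (ℚᵘ.≃-sym (toℚᵘ-ι a)) (ℚᵘ.≃-trans (ℚᵘ.≃-reflexive (cong toℚᵘ eq)) (toℚᵘ-ι b))
... | *≡* r = ℤ.+-injective (trans (sym (ℤ.*-identityʳ (ℤ.+ a))) (trans r (ℤ.*-identityʳ (ℤ.+ b))))

ι-* : ∀ a b → ι (a * b) ≡ ι a ℚ.* ι b
ι-* a b = ℚ.toℚᵘ-injective (begin
  toℚᵘ (ι (a * b))                 ≈⟨ toℚᵘ-ι (a * b) ⟩
  mkℚᵘ (ℤ.+ (a * b)) 0             ≈⟨ *≡* (cong (ℤ._* ℤ.+ 1) (ℤ.pos-* a b)) ⟩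
  mkℚᵘ (ℤ.+ a) 0 ℚᵘ.* mkℚᵘ (ℤ.+ b) 0   ≈⟨ ℚᵘ.*-cong (toℚᵘ-ι a) (toℚᵘ-ι b) ⟨
  toℚᵘ (ι a) ℚᵘ.* toℚᵘ (ι b)       ≈⟨ ℚ.toℚᵘ-homo-* (ι a) (ι b) ⟨
  toℚᵘ (ι a ℚ.* ι b)               ∎)
  where open import Relation.Binary.Reasoning.Setoid ℚᵘ.≃-setoid

ι-+ : ∀ a b → ι (a + b) ≡ ι a ℚ.+ ι b
ι-+ a b = ℚ.toℚᵘ-injective (begin
  toℚᵘ (ι (a + b))                 ≈⟨ toℚᵘ-ι (a + b) ⟩
  mkℚᵘ (ℤ.+ (a + b)) 0             ≈⟨ *≡* (cong (ℤ._* ℤ.+ 1) (sym (cong₂ ℤ._+_ (ℤ.*-identityʳ (ℤ.+ a)) (ℤ.*-identityʳ (ℤ.+ b))))) ⟩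
  mkℚᵘ (ℤ.+ a) 0 ℚᵘ.+ mkℚᵘ (ℤ.+ b) 0   ≈⟨ ℚᵘ.+-cong (toℚᵘ-ι a) (toℚᵘ-ι b) ⟨
  toℚᵘ (ι a) ℚᵘ.+ toℚᵘ (ι b)       ≈⟨ ℚ.toℚᵘ-homo-+ (ι a) (ι b) ⟨
  toℚᵘ (ι a ℚ.+ ι b)               ∎)
  where open import Relation.Binary.Reasoning.Setoid ℚᵘ.≃-setoid

denominator : ∀ w → 0ℚ ℚ.≤ w → ∃ λ D → NonZero D × ∃ λ c → w ℚ.* ι D ≡ ι c
denominator w@(mkℚ (ℤ.+ a) d _) _ = suc d , _ , a , ℚ.toℚᵘ-injective (begin
  toℚᵘ (w ℚ.* ι (suc d))                ≈⟨ ℚ.toℚᵘ-homo-* w (ι (suc d)) ⟩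
  mkℚᵘ (ℤ.+ a) d ℚᵘ.* toℚᵘ (ι (suc d))    ≈⟨ ℚᵘ.*-cong (ℚᵘ.≃-refl {mkℚᵘ (ℤ.+ a) d}) (toℚᵘ-ι (suc d)) ⟩
  mkℚᵘ (ℤ.+ a) d ℚᵘ.* mkℚᵘ (ℤ.+ suc d) 0    ≈⟨ *≡* (trans (ℤ.*-identityʳ _) (cong (λ e → ℤ.+ a ℤ.* ℤ.+ e) (sym (*-identityʳ (suc d))))) ⟩
  mkℚᵘ (ℤ.+ a) 0                          ≈⟨ toℚᵘ-ι a ⟨
  toℚᵘ (ι a)                            ∎)
  where open import Relation.Binary.Reasoning.Setoid ℚᵘ.≃-setoid
denominator w@(mkℚ (ℤ.-[1+ a ]) d _) (ℚ.*≤* ())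

-- The separate denominators are multiplied together, so each numerator picks up the denominators of
-- the other weights.
common-denominator : ∀ {m} (w : Fin m → ℚ) → (∀ j → 0ℚ ℚ.≤ w j) →
                     ∃ λ D → NonZero D × Σ (Fin m → ℕ) λ c → ∀ j → w j ℚ.* ι D ≡ ι (c j)
common-denominator {zero}  w w≥0 = 1 , _ , (λ ()) , λ ()
common-denominator {suc m} w w≥0
  with d , d≢0 , a , eq ← denominator (w zero) (w≥0 zero)
     | D , D≢0 , c , eqs ← common-denominator (w ∘ suc) (w≥0 ∘ suc) =
  d * D , m*n≢0 d D {{d≢0}} {{D≢0}} , scaled , correct
  where
  scaled : Fin (suc m) → ℕ
  scaled zero    = a * D
  scaled (suc j) = c j * d
  rescale : ∀ x n D D′ → x ℚ.* ι D ≡ ι n → x ℚ.* ι (D * D′) ≡ ι (n * D′)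
  rescale x n D D′ eq = begin
    x ℚ.* ι (D * D′)      ≡⟨ cong (x ℚ.*_) (ι-* D D′) ⟩
    x ℚ.* (ι D ℚ.* ι D′)  ≡⟨ ℚ.*-assoc x (ι D) (ι D′) ⟨
    x ℚ.* ι D ℚ.* ι D′    ≡⟨ cong (ℚ._* ι D′) eq ⟩
    ι n ℚ.* ι D′          ≡⟨ ι-* n D′ ⟨
    ι (n * D′)            ∎
    where open ≡-Reasoning
  correct : ∀ j → w j ℚ.* ι (d * D) ≡ ι (scaled j)
  correct zero    = rescale (w zero) a d D eq
  correct (suc j) = trans (cong (λ e → w (suc j) ℚ.* ι e) (*-comm d D)) (rescale (w (suc j)) (c j) D d (eqs j))

sumℚ-scaled : ∀ {m} D (u : Fin m → ℚ) c → (∀ j → u j ℚ.* ι D ≡ ι (c j)) → sumℚ u ℚ.* ι D ≡ ι (fold true c)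
sumℚ-scaled {zero}  D u c eq = ℚ.*-zeroˡ (ι D)
sumℚ-scaled {suc m} D u c eq = begin
  (u zero ℚ.+ sumℚ (u ∘ suc)) ℚ.* ι D             ≡⟨ ℚ.*-distribʳ-+ (ι D) (u zero) (sumℚ (u ∘ suc)) ⟩
  u zero ℚ.* ι D ℚ.+ sumℚ (u ∘ suc) ℚ.* ι D       ≡⟨ cong₂ ℚ._+_ (eq zero) (sumℚ-scaled D (u ∘ suc) (c ∘ suc) (eq ∘ suc)) ⟩
  ι (c zero) ℚ.+ ι (fold true (c ∘ suc))          ≡⟨ ι-+ (c zero) (fold true (c ∘ suc)) ⟨
  ι (c zero + fold true (c ∘ suc))                ∎
  where open ≡-Reasoning

repeated : ∀ {I : Set} {m} → (Fin m → I) → (Fin m → ℕ) → List I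
repeated e c = concat (L.tabulate (λ j → L.replicate (c j) (e j)))

length-repeated : ∀ {I : Set} {m} (e : Fin m → I) c → length (repeated e c) ≡ fold true c
length-repeated e c = trans (length-concat-tabulate (λ j → L.replicate (c j) (e j)))
                            (fold-cong true (λ j → length-replicate (c j)))

length-filterᵇ-replicate : ∀ {I : Set} (b : I → Bool) n x →
                           length (filterᵇ b (L.replicate n x)) ≡ (if b x then n else 0)
length-filterᵇ-replicate b zero    x with b x
... | true  = refl
... | false = refl
length-filterᵇ-replicate b (suc n) x with b x | length-filterᵇ-replicate b n x
... | true  | eq = cong suc eq
... | false | eq = eq

length-filterᵇ-repeated : ∀ {I : Set} {m} (b : I → Bool) (e : Fin m → I) c →
                          length (filterᵇ b (repeated e c)) ≡ fold true (λ j → if b (e j) then c j else 0)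
length-filterᵇ-repeated {m = zero}  b e c = refl
length-filterᵇ-repeated {m = suc m} b e c = begin
  length (filterᵇ b (first ++ rest))                    ≡⟨ cong length (filter-++ _ first rest) ⟩
  length (filterᵇ b first ++ filterᵇ b rest)            ≡⟨ length-++ (filterᵇ b first) ⟩
  length (filterᵇ b first) + length (filterᵇ b rest)
    ≡⟨ cong₂ _+_ (length-filterᵇ-replicate b (c zero) (e zero)) (length-filterᵇ-repeated b (e ∘ suc) (c ∘ suc)) ⟩
  (if b (e zero) then c zero else 0) + fold true (λ j → if b (e (suc j)) then c (suc j) else 0) ∎
  where
  open ≡-Reasoning
  first = L.replicate (c zero) (e zero)
  rest = repeated (e ∘ suc) (c ∘ suc)

-- With `D` a common denominator of the distribution `w`, the list `J` repeats each member `j`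
-- exactly D · w j times. Its length is then `D`, and the regularity condition times `D` gives the
-- counts.
regular⇒uniform-cover : ∀ {p q} (F : Family p q) → Regular F →
  Σ (List (Fin (arity F))) λ J → NonZero (length J) ×
    (∀ i → p * length (filterᵇ (λ j → contains (memb F j) i) J) ≡ q * length J)
regular⇒uniform-cover {p} {q} F (w , w≥0 , w-sum , w-cover)
  with D , D≢0 , c , eq ← common-denominator w w≥0 = J , subst NonZero (sym |J|≡D) D≢0 , covered
  where
  open ≡-Reasoning
  J : List (Fin (arity F))
  J = repeated (λ j → j) c
  |J|≡D : length J ≡ D
  |J|≡D = trans (length-repeated (λ j → j) c) (ι-injective (begin
    ι (fold true c)    ≡⟨ sumℚ-scaled D w c eq ⟨
    sumℚ w ℚ.* ι D     ≡⟨ cong (ℚ._* ι D) w-sum ⟩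
    1ℚ ℚ.* ι D         ≡⟨ ℚ.*-identityˡ (ι D) ⟩
    ι D                ∎))
  covered : ∀ i → p * length (filterᵇ (λ j → contains (memb F j) i) J) ≡ q * length J
  covered i = ι-injective (begin
    ι (p * length (filterᵇ b J))           ≡⟨ cong (λ k → ι (p * k)) (length-filterᵇ-repeated b (λ j → j) c) ⟩
    ι (p * fold true c′)                   ≡⟨ ι-* p (fold true c′) ⟩
    ι p ℚ.* ι (fold true c′)               ≡⟨ cong (ι p ℚ.*_) (sumℚ-scaled D u c′ eq′) ⟨
    ι p ℚ.* (sumℚ u ℚ.* ι D)               ≡⟨ ℚ.*-assoc (ι p) (sumℚ u) (ι D) ⟨
    ι p ℚ.* sumℚ u ℚ.* ι D                 ≡⟨ cong (ℚ._* ι D) (w-cover i) ⟩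
    ι q ℚ.* ι D                            ≡⟨ ι-* q D ⟨
    ι (q * D)                              ≡⟨ cong (λ k → ι (q * k)) |J|≡D ⟨
    ι (q * length J)                       ∎)
    where
    b = λ j → contains (memb F j) i
    u = λ j → if b j then w j else 0ℚ
    c′ = λ j → if b j then c j else 0
    eq′ : ∀ j → u j ℚ.* ι D ≡ ι (c′ j)
    eq′ j with b j
    ... | true  = eq j
    ... | false = ℚ.*-zeroˡ (ι D)

-- Independent colourings

xsum : ∀ {k} → (Fin k → Bool) → Bool
xsum {zero}  f = false
xsum {suc k} f = f zero xor xsum (f ∘ suc)

xsum-cong : ∀ {k} {f g : Fin k → Bool} → (∀ l → f l ≡ g l) → xsum f ≡ xsum g
xsum-cong {zero}  eq = refl
xsum-cong {suc k} eq = cong₂ _xor_ (eq zero) (xsum-cong (eq ∘ suc))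

xor-cancelˡ : ∀ x {y z} → x xor y ≡ x xor z → y ≡ z
xor-cancelˡ false eq = eq
xor-cancelˡ true  {false} {false} eq = refl
xor-cancelˡ true  {true}  {true}  eq = refl

xor-cancelʳ : ∀ x {y z} → y xor x ≡ z xor x → y ≡ z
xor-cancelʳ x {false} {false} eq = refl
xor-cancelʳ x {true}  {true}  eq = refl
xor-cancelʳ false {false} {true} ()
xor-cancelʳ true  {false} {true} ()
xor-cancelʳ false {true} {false} ()
xor-cancelʳ true  {true} {false} ()

-- Over F₂ the terms on which `f` and `g` agree cancel from the two equal sums, leaving the one at
-- `l`.
xsum-differ : ∀ {k} {f g : Fin k → Bool} l → (∀ l′ → l′ ≢ l → f l′ ≡ g l′) → xsum f ≡ xsum g → f l ≡ g l
xsum-differ {f = f} {g} zero    agree eq =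
  xor-cancelʳ (xsum (f ∘ suc)) (trans eq (cong (g zero xor_) (sym (xsum-cong (λ l → agree (suc l) λ ())))))
xsum-differ {f = f} {g} (suc l) agree eq =
  xsum-differ l (λ l′ neq → agree (suc l′) (neq ∘ Fin.suc-injective))
    (xor-cancelˡ (f zero) (trans eq (cong (_xor xsum (g ∘ suc)) (sym (agree zero λ ())))))

funToFin-cong : ∀ {m n} {f g : Fin m → Fin n} → (∀ i → f i ≡ g i) → funToFin f ≡ funToFin g
funToFin-cong {zero}  eq = refl
funToFin-cong {suc m} eq = cong₂ Fin.combine (eq zero) (funToFin-cong (eq ∘ suc))

finToFun-injective : ∀ {m n} (a b : Fin (n ^ m)) → (∀ i → finToFun {n} {m} a i ≡ finToFun b i) → a ≡ b
finToFun-injective {m} {n} a b eq =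
  trans (sym (funToFin-finToFin {m} {n} a)) (trans (funToFin-cong eq) (funToFin-finToFin {m} {n} b))

open Inverse 2↔Bool using ()
  renaming (to to toBool; from to fromBool; strictlyInverseˡ to toBool-fromBool; strictlyInverseʳ to fromBool-toBool)

-- Codes in a finite type serve two ends: pointwise equal functions become propositionally equal
-- without extensionality, and the pigeonhole principle `injective⇒≤` applies.
encode : ∀ {k} → (Fin k → Bool) → Fin (2 ^ k)
encode f = funToFin (fromBool ∘ f)

encode-cong : ∀ {k} {f g : Fin k → Bool} → (∀ l → f l ≡ g l) → encode f ≡ encode g
encode-cong eq = funToFin-cong (cong fromBool ∘ eq)

decode : ∀ {k} → Fin (2 ^ k) → Fin k → Bool
decode a = toBool ∘ finToFun a

decode-encode : ∀ {k} (f : Fin k → Bool) l → decode (encode f) l ≡ f l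
decode-encode f l = trans (cong toBool (finToFun-funToFin (fromBool ∘ f) l)) (toBool-fromBool (f l))

decode-injective : ∀ {k} (a b : Fin (2 ^ k)) → (∀ l → decode {k} a l ≡ decode b l) → a ≡ b
decode-injective {k} a b eq = finToFun-injective {k} a b
  (λ l → trans (sym (fromBool-toBool (finToFun {2} {k} a l)))
               (trans (cong fromBool (eq l)) (fromBool-toBool (finToFun {2} {k} b l))))

encode-injective : ∀ {k} {f g : Fin k → Bool} → encode f ≡ encode g → ∀ l → f l ≡ g l
encode-injective {f = f} {g} eq l =
  trans (sym (decode-encode f l)) (trans (cong (λ a → decode a l) eq) (decode-encode g l))

-- Over F₂ the functionals c ↦ c (s l) + c (t l) are dual to the vectors c l, which are therefore
-- linearly independent in F₂^N; the bound is read off from the 2 ^ k distinct combinations.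
independent-colourings : ∀ {k N} (s t : Fin k → Fin N) (c : Fin k → Fin N → Bool) →
                         (∀ l l′ → l′ ≢ l → c l′ (s l) ≡ c l′ (t l)) →
                         (∀ l → c l (s l) ≢ c l (t l)) → k ≤ N
independent-colourings {k} {N} s t c same differ =
  ≮⇒≥ (λ N<k → <⇒≱ (^-monoʳ-< 2 (s≤s (s≤s z≤n)) N<k) (injective⇒≤ combination-injective))
  where
  value : (Fin k → Bool) → Fin N → Bool
  value a x = xsum (λ l → a l ∧ c l x)
  combination : Fin (2 ^ k) → Fin (2 ^ N)
  combination a = encode (value (decode a))
  -- Only the `l`-th summand can tell `s l` from `t l`, so comparing the values at these two points
  -- reads off the coefficient `a l`.
  value-true : ∀ a l → a l ≡ true → value a (s l) ≢ value a (t l)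
  value-true a l eq v with xsum-differ l (λ l′ neq → cong (a l′ ∧_) (same l l′ neq)) v
  ... | r rewrite eq = differ l r
  value-false : ∀ a l → a l ≡ false → value a (s l) ≡ value a (t l)
  value-false a l eq = xsum-cong agree
    where
    agree : ∀ l′ → a l′ ∧ c l′ (s l) ≡ a l′ ∧ c l′ (t l)
    agree l′ with l′ Fin.≟ l
    ... | yes refl rewrite eq = refl
    ... | no neq = cong (a l′ ∧_) (same l l′ neq)
  coefficient : ∀ a b → (∀ x → value a x ≡ value b x) → ∀ l → a l ≡ b l
  coefficient a b eq l with a l in ea | b l in eb
  ... | true  | true  = refl
  ... | false | false = refl
  ... | true  | false = contradiction (trans (eq (s l)) (trans (value-false b l eb) (sym (eq (t l))))) (value-true a l ea)
  ... | false | true  = contradiction (trans (sym (eq (s l))) (trans (value-false a l ea) (eq (t l)))) (value-true b l eb)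
  combination-injective : Injective _≡_ _≡_ combination
  combination-injective {a} {b} eq =
    decode-injective {k} a b (coefficient (decode a) (decode b) (encode-injective eq))

-- The upper bound

lookup-extensional : ∀ {A : Set} {m} {xs ys : Vec A m} → (∀ i → V.lookup xs i ≡ V.lookup ys i) → xs ≡ ys
lookup-extensional {xs = xs} {ys} eq =
  trans (sym (tabulate∘lookup xs)) (trans (tabulate-cong eq) (tabulate∘lookup ys))

length-filter-¬ : ∀ {A : Set} {P : A → Set} (P? : Decidable P) xs →
                  length (filter P? xs) + length (filter (¬? ∘ P?) xs) ≡ length xs
length-filter-¬ P? []       = refl
length-filter-¬ P? (x ∷ xs) with P? x
... | yes _ = cong suc (length-filter-¬ P? xs)
... | no  _ = trans (+-suc _ _) (cong suc (length-filter-¬ P? xs))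

contains⇒∃ : ∀ {p q} (S : Vec (Fin p) q) i → contains S i ≡ true → ∃ λ a → V.lookup S a ≡ i
contains⇒∃ S i eq with VMem._∈?_ Fin._≟_ i S
... | yes i∈S = VAny.index i∈S , sym (VAny.lookup-index i∈S)

filterᵇ-nonempty : ∀ {A : Set} (b : A → Bool) xs → NonZero (length (filterᵇ b xs)) → ∃ λ x → b x ≡ true
filterᵇ-nonempty b (x ∷ xs) ne with b x in eq
... | true  = x , eq
... | false = filterᵇ-nonempty b xs ne

module Uniform {p q} (F : Family p q) (J : List (Fin (arity F))) (t : ℕ) {{_ : NonZero t}}
               (cover : ∀ i → length (filterᵇ (λ j → contains (memb F j) i) J) ≡ t) where

  -- A nonzero cover count puts each coordinate into some member. The place chosen here is where
  -- that bit of x is read from a projection.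
  position : ∀ i → ∃ λ j → ∃ λ a → V.lookup (memb F j) a ≡ i
  position i with j , j∋i ← filterᵇ-nonempty (λ j → contains (memb F j) i) J (subst NonZero (sym (cover i)) it)
    = j , contains⇒∃ (memb F j) i j∋i

  module Upper {n} (Y : List (Clause n (arity F))) (nr : NonRedundant (OR-DP F) Y) where

    N = length Y

    σ : Fin N → Fin n → E q
    σ i = proj₁ (proj₂ nr i)

    variable-at : Fin N → Fin (arity F) → Fin n
    variable-at k j = V.lookup (L.lookup Y k) j

    -- The first index is the assignment, the second the clause: on the diagonal the clause is
    -- violated, off it the clause is satisfied.
    τ : Fin N → Fin N → Fin (arity F) → Fin q → Bool
    τ i k j a = V.lookup (σ i (variable-at k j)) a

    τ-projection : ∀ {i k} → k ≢ i →
                   ∃ λ x → x ≢ V.replicate p false × ∀ j a → τ i k j a ≡ V.lookup x (V.lookup (memb F j) a)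
    τ-projection {i} {k} k≢i with x , x≢0 , eq ← proj₁ (proj₂ (proj₂ nr i)) k k≢i =
      x , x≢0 , λ j a → trans (cong (λ v → V.lookup v a) (eq j)) (lookup-map a (V.lookup x) (memb F j))

    -- The clause breaks one of the equations that make a tuple a projection: two places meant for
    -- the same bit of x carry different values.
    Conflict : Fin N → Set
    Conflict i = ∃ λ j → ∃ λ a → ∃ λ j′ → ∃ λ a′ →
                 V.lookup (memb F j) a ≡ V.lookup (memb F j′) a′ × τ i i j a ≢ τ i i j′ a′

    conflict? : Decidable Conflict
    conflict? i = any? λ j → any? λ a → any? λ j′ → any? λ a′ →
                  (V.lookup (memb F j) a Fin.≟ V.lookup (memb F j′) a′) ×-dec ¬? (τ i i j a Bool.≟ τ i i j′ a′)

    -- Off the diagonal clause `k` is satisfied and hence mapped to a projection; on the diagonal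
    -- the absence of a conflict says the same.
    consistent : ∀ {k} → ¬ Conflict k → ∀ i {j a j′ a′} → V.lookup (memb F j) a ≡ V.lookup (memb F j′) a′ →
                 τ i k j a ≡ τ i k j′ a′
    consistent {k} ok i {j} {a} {j′} {a′} same with k Fin.≟ i
    ... | yes refl = decidable-stable (τ i i j a Bool.≟ τ i i j′ a′) (λ neq → ok (j , a , j′ , a′ , same , neq))
    ... | no k≢i with x , _ , eq ← τ-projection k≢i =
      trans (eq j a) (trans (cong (V.lookup x) same) (sym (eq j′ a′)))

    coordinate : Fin N → Fin N → Fin p → Bool
    coordinate i k c = τ i k (proj₁ (position c)) (proj₁ (proj₂ (position c)))

    coordinate-τ : ∀ {k} → ¬ Conflict k → ∀ i j a → coordinate i k (V.lookup (memb F j) a) ≡ τ i k j a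
    coordinate-τ ok i j a = consistent ok i (proj₂ (proj₂ (position (V.lookup (memb F j) a))))

    -- Without a conflict the image of clause `i` is the projection of the vector of these bits;
    -- were that vector nonzero, the clause would be satisfied.
    coordinate-self : ∀ {i} → ¬ Conflict i → ∀ c → coordinate i i c ≡ false
    coordinate-self {i} ok c with ≡-dec Bool._≟_ (V.tabulate (coordinate i i)) (V.replicate p false)
    ... | yes x≡0 = trans (sym (lookup∘tabulate (coordinate i i) c))
                          (trans (cong (λ x → V.lookup x c) x≡0) (lookup-replicate c false))
    ... | no x≢0 = contradiction (x , x≢0 , λ j → lookup-extensional (λ a → trans (sym (coordinate-τ ok i j a))
                     (trans (sym (lookup∘tabulate (coordinate i i) _)) (sym (lookup-map a (V.lookup x) (memb F j))))))
                     (proj₂ (proj₂ (proj₂ nr i)))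
      where x = V.tabulate (coordinate i i)

    conflicting consistents : List (Fin N)
    conflicting = filter conflict? (allFin N)
    consistents = filter (¬? ∘ conflict?) (allFin N)

    -- The points to be coloured are the `n * q` pairs of a variable and a bit position, the
    -- colourings are the violating assignments, and the two points attached to `l` are the places
    -- of the conflict in clause `l`.
    conflicting-bound : length conflicting ≤ n * q
    conflicting-bound = independent-colourings
      (λ l → combine (variable-at (clause l) (j₁ l)) (a₁ l))
      (λ l → combine (variable-at (clause l) (j₂ l)) (a₂ l))
      colour
      (λ l l′ l′≢l → trans (colour-combine l′ (clause l) (j₁ l) (a₁ l))
                       (trans (agree l l′ l′≢l) (sym (colour-combine l′ (clause l) (j₂ l) (a₂ l)))))
      (λ l eq → proj₂ (proj₂ (proj₂ (proj₂ (proj₂ (witness l)))))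
                  (trans (sym (colour-combine l (clause l) (j₁ l) (a₁ l)))
                    (trans eq (colour-combine l (clause l) (j₂ l) (a₂ l)))))
      where
      clause : Fin (length conflicting) → Fin N
      clause = L.lookup conflicting
      witness : ∀ l → Conflict (clause l)
      witness l = All.lookup (All.all-filter conflict? (allFin N)) (∈-lookup l)
      j₁ j₂ : Fin (length conflicting) → Fin (arity F)
      a₁ a₂ : Fin (length conflicting) → Fin q
      j₁ = proj₁ ∘ witness
      a₁ = proj₁ ∘ proj₂ ∘ witness
      j₂ = proj₁ ∘ proj₂ ∘ proj₂ ∘ witness
      a₂ = proj₁ ∘ proj₂ ∘ proj₂ ∘ proj₂ ∘ witness
      colour : Fin (length conflicting) → Fin (n * q) → Bool
      colour l x = V.lookup (σ (clause l) (proj₁ (remQuot {n} q x))) (proj₂ (remQuot {n} q x))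
      colour-combine : ∀ l k j a → colour l (combine (variable-at k j) a) ≡ τ (clause l) k j a
      colour-combine l k j a =
        cong (λ va → V.lookup (σ (clause l) (proj₁ va)) (proj₂ va)) (remQuot-combine {n} {q} (variable-at k j) a)
      agree : ∀ l l′ → l′ ≢ l → τ (clause l′) (clause l) (j₁ l) (a₁ l) ≡ τ (clause l′) (clause l) (j₂ l) (a₂ l)
      agree l l′ l′≢l
        with x , _ , eq ← τ-projection (l′≢l ∘ sym ∘ lookup-injective (Unique.filter⁺ conflict? (Unique.allFin⁺ N))) =
        trans (eq (j₁ l) (a₁ l)) (trans (cong (V.lookup x) (proj₁ (proj₂ (proj₂ (proj₂ (proj₂ (witness l)))))))
          (sym (eq (j₂ l) (a₂ l))))

    consistents-bound : length consistents ^ t ≤ n ^ length J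
    consistents-bound =
      shearer-count J (λ j → contains (memb F j)) t cover z z-injective (λ j l → variable-at (clause l) j) determined
      where
      k = length consistents
      clause : Fin k → Fin N
      clause = L.lookup consistents
      ok : ∀ l → ¬ Conflict (clause l)
      ok l = All.lookup (All.all-filter (¬? ∘ conflict?) (allFin N)) (∈-lookup l)
      clause-injective : ∀ {l l′} → clause l ≡ clause l′ → l ≡ l′
      clause-injective = lookup-injective (Unique.filter⁺ (¬? ∘ conflict?) (Unique.allFin⁺ N))
      -- One bit of the clause is recorded under all `k` violating assignments, hence an alphabet of
      -- size `2 ^ k`; this size does not enter the bound.
      row : Fin k → Fin p → Fin (2 ^ k)
      row l c = encode (λ l′ → coordinate (clause l′) (clause l) c)
      z : Fin k → Vec (Fin (2 ^ k)) p
      z l = V.tabulate (row l)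
      z-lookup : ∀ {l l′} c → V.lookup (z l) c ≡ V.lookup (z l′) c → row l c ≡ row l′ c
      z-lookup {l} {l′} c eq = trans (sym (lookup∘tabulate (row l) c)) (trans eq (lookup∘tabulate (row l′) c))
      -- The assignment violating clause `l` reads only zeros there. If the rows coincide, it reads
      -- only zeros at clause `l′` as well, although it satisfies that clause.
      z-injective : ∀ {l l′} → z l ≡ z l′ → l ≡ l′
      z-injective {l} {l′} eq with l′ Fin.≟ l
      ... | yes l′≡l = sym l′≡l
      ... | no l′≢l with x , x≢0 , eqx ← τ-projection (l′≢l ∘ clause-injective) =
        contradiction (lookup-extensional (λ c → trans (zero-at c) (sym (lookup-replicate c false)))) x≢0
        where
        open ≡-Reasoning
        zero-at : ∀ c → V.lookup x c ≡ false
        zero-at c = begin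
          V.lookup x c                                      ≡⟨ cong (V.lookup x) (proj₂ (proj₂ (position c))) ⟨
          V.lookup x (V.lookup (memb F (proj₁ (position c))) (proj₁ (proj₂ (position c)))) ≡⟨ eqx _ _ ⟨
          coordinate (clause l) (clause l′) c
            ≡⟨ encode-injective (z-lookup {l} {l′} c (cong (λ v → V.lookup v c) eq)) l ⟨
          coordinate (clause l) (clause l) c                ≡⟨ coordinate-self (ok l) c ⟩
          false                                             ∎
      -- For `c` in member `j` the bit can be read at that member, where it depends only on the
      -- variable in place `j`.
      determined : ∀ j {l l′} → variable-at (clause l) j ≡ variable-at (clause l′) j →
                   ∀ c → contains (memb F j) c ≡ true → V.lookup (z l) c ≡ V.lookup (z l′) c
      determined j {l} {l′} eq c j∋c with a , refl ← contains⇒∃ (memb F j) c j∋c =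
        trans (lookup∘tabulate (row l) c) (trans (encode-cong (λ l″ → begin
            coordinate (clause l″) (clause l) c    ≡⟨ coordinate-τ (ok l) (clause l″) j a ⟩
            τ (clause l″) (clause l) j a           ≡⟨ cong (λ v → V.lookup (σ (clause l″) v) a) eq ⟩
            τ (clause l″) (clause l′) j a          ≡⟨ coordinate-τ (ok l′) (clause l″) j a ⟨
            coordinate (clause l″) (clause l′) c   ∎))
          (sym (lookup∘tabulate (row l′) c)))
        where open ≡-Reasoning

    length-bound : N ≤ n * q + length consistents
    length-bound = begin
      N                                        ≡⟨ length-tabulate {n = N} (λ i → i) ⟨
      length (allFin N)                        ≡⟨ length-filter-¬ conflict? (allFin N) ⟨
      length conflicting + length consistents  ≤⟨ +-monoˡ-≤ (length consistents) conflicting-bound ⟩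
      n * q + length consistents               ∎
      where open ≤-Reasoning

-- The lower bound

module Lower {p q} (F : Family p q) (position : ∀ i → ∃ λ j → ∃ λ a → V.lookup (memb F j) a ≡ i)
             {m n} (fits : (p * m) ^ q ≤ n) where

  -- A point of [m]^p restricted to S is stored as the function a ↦ (S a , z (S a)), so that the
  -- variables of different members S need no further tag.
  variable-of : (Fin p → Fin m) → Fin (arity F) → Fin n
  variable-of z j = inject≤ (funToFin (λ a → combine (V.lookup (memb F j) a) (z (V.lookup (memb F j) a)))) fits

  clause : Fin (m ^ p) → Clause n (arity F)
  clause c = V.tabulate (variable-of (finToFun c))

  differs : (Fin p → Fin m) → Fin p × Fin m → Bool
  differs z (i , x) = not (does (z i Fin.≟ x))

  σ : (Fin p → Fin m) → Fin n → E q
  σ z v with toℕ v <? (p * m) ^ q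
  ... | yes v<K = V.tabulate (λ a → differs z (remQuot m (finToFun (fromℕ< v<K) a)))
  -- Variables beyond the first `(p * m) ^ q` occur in no clause, so this value is arbitrary.
  ... | no  _   = V.replicate q false

  σ-inject : ∀ z u → σ z (inject≤ u fits) ≡ V.tabulate (λ a → differs z (remQuot m (finToFun u a)))
  σ-inject z u with toℕ (inject≤ u fits) <? (p * m) ^ q
  ... | yes u<K = cong (λ u → V.tabulate (λ a → differs z (remQuot m (finToFun u a))))
                       (toℕ-injective (trans (toℕ-fromℕ< u<K) (toℕ-inject≤ u fits)))
  ... | no  u≮K = contradiction (subst (_< (p * m) ^ q) (sym (toℕ-inject≤ u fits)) (toℕ<n u)) u≮K

  difference : Fin (m ^ p) → Fin (m ^ p) → Vec Bool p
  difference c d = V.tabulate (λ i → differs (finToFun c) (i , finToFun d i))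

  σ-clause : ∀ c d j → σ (finToFun c) (V.lookup (clause d) j) ≡ restrict (difference c d) (memb F j)
  σ-clause c d j = begin
    σ z (V.lookup (clause d) j)     ≡⟨ cong (σ z) (lookup∘tabulate (variable-of (finToFun d)) j) ⟩
    σ z (variable-of (finToFun d) j) ≡⟨ σ-inject z (funToFin g) ⟩
    V.tabulate (λ a → differs z (remQuot m (finToFun (funToFin g) a))) ≡⟨ lookup-extensional coordinatewise ⟩
    restrict (difference c d) (memb F j) ∎
    where
    open ≡-Reasoning
    z = finToFun c
    S = V.lookup (memb F j)
    g : Fin q → Fin (p * m)
    g a = combine (S a) (finToFun d (S a))
    coordinatewise : ∀ a → V.lookup (V.tabulate (λ a → differs z (remQuot m (finToFun (funToFin g) a)))) a
                         ≡ V.lookup (restrict (difference c d) (memb F j)) a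
    coordinatewise a = begin
      V.lookup (V.tabulate (λ a → differs z (remQuot m (finToFun (funToFin g) a)))) a
        ≡⟨ lookup∘tabulate _ a ⟩
      differs z (remQuot m (finToFun (funToFin g) a))
        ≡⟨ cong (λ x → differs z (remQuot m x)) (finToFun-funToFin g a) ⟩
      differs z (remQuot m (g a))
        ≡⟨ cong (differs z) (remQuot-combine (S a) (finToFun d (S a))) ⟩
      differs z (S a , finToFun d (S a))
        ≡⟨ lookup∘tabulate (λ i → differs z (i , finToFun d i)) (S a) ⟨
      V.lookup (difference c d) (S a)
        ≡⟨ lookup-map a (V.lookup (difference c d)) (memb F j) ⟨
      V.lookup (restrict (difference c d) (memb F j)) a ∎

  difference-zero⇒≡ : ∀ c d → difference c d ≡ V.replicate p false → c ≡ d
  difference-zero⇒≡ c d eq = finToFun-injective {p} c d same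
    where
    same : ∀ i → finToFun {m} {p} c i ≡ finToFun d i
    same i with finToFun {m} {p} c i Fin.≟ finToFun d i
              | trans (sym (lookup∘tabulate (λ i → differs (finToFun c) (i , finToFun d i)) i))
                      (trans (cong (λ x → V.lookup x i) eq) (lookup-replicate i false))
    ... | yes r | _ = r
    ... | no  _ | ()

  difference-self : ∀ c i → V.lookup (difference c c) i ≡ false
  difference-self c i = trans (lookup∘tabulate (λ i → differs (finToFun c) (i , finToFun c i)) i)
                              (cong not (dec-true (finToFun c i Fin.≟ finToFun c i) refl))

  satisfies : ∀ {c d} → c ≢ d → Satisfies (OR-DP F) (σ (finToFun c)) (clause d)
  satisfies {c} {d} c≢d = difference c d , c≢d ∘ difference-zero⇒≡ c d , σ-clause c d

  -- Every coordinate lies in some member, so the projection determines `x`; it is the projection of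
  -- `difference c c`, which is zero.
  violates : ∀ c → ¬ Satisfies (OR-DP F) (σ (finToFun c)) (clause c)
  violates c (x , x≢0 , eq) = x≢0 (lookup-extensional (λ i → trans (zero-at i) (sym (lookup-replicate i false))))
    where
    open ≡-Reasoning
    zero-at : ∀ i → V.lookup x i ≡ false
    zero-at i with j , a , refl ← position i = begin
      V.lookup x (V.lookup (memb F j) a)                         ≡⟨ lookup-map a (V.lookup x) (memb F j) ⟨
      V.lookup (restrict x (memb F j)) a
        ≡⟨ cong (λ v → V.lookup v a) (trans (sym (eq j)) (σ-clause c c j)) ⟩
      V.lookup (restrict (difference c c) (memb F j)) a          ≡⟨ lookup-map a (V.lookup (difference c c)) (memb F j) ⟩
      V.lookup (difference c c) (V.lookup (memb F j) a)          ≡⟨ difference-self c (V.lookup (memb F j) a) ⟩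
      false                                                      ∎

  -- The assignment of `c` violates `clause c` and satisfies every `clause d` with `d` different
  -- from `c`, so it separates the two.
  clause-injective : ∀ {c d} → clause c ≡ clause d → c ≡ d
  clause-injective {c} {d} eq with c Fin.≟ d
  ... | yes c≡d = c≡d
  ... | no  c≢d = contradiction (subst (Satisfies (OR-DP F) (σ (finToFun c))) (sym eq) (satisfies c≢d)) (violates c)

  nonRedundant : NonRedundant (OR-DP F) (L.tabulate clause)
  nonRedundant = Unique.tabulate⁺ clause-injective , isolate
    where
    Y = L.tabulate clause
    isolate : ∀ i → Σ (Fin n → E q) λ ρ →
              (∀ k → k ≢ i → Satisfies (OR-DP F) ρ (L.lookup Y k)) × ¬ Satisfies (OR-DP F) ρ (L.lookup Y i)
    isolate i with c , eqc ← ∈-tabulate⁻ (∈-lookup {xs = Y} i) =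
      σ (finToFun c) , others , λ sat → violates c (subst (Satisfies (OR-DP F) (σ (finToFun c))) eqc sat)
      where
      others : ∀ k → k ≢ i → Satisfies (OR-DP F) (σ (finToFun c)) (L.lookup Y k)
      others k k≢i with d , eqd ← ∈-tabulate⁻ (∈-lookup {xs = Y} k) =
        subst (Satisfies (OR-DP F) (σ (finToFun c))) (sym eqd)
          (satisfies (λ c≡d → k≢i (lookup-injective (Unique.tabulate⁺ clause-injective)
                                      (trans eqd (trans (cong clause (sym c≡d)) (sym eqc))))))

-- Choice of the grid and the constants

threshold : ∀ (f : ℕ → ℕ) n b → f 0 ≤ n → n < f b → ∃ λ m → f m ≤ n × n < f (suc m)
threshold f n zero    f0≤n n<f0 = contradiction f0≤n (<⇒≱ n<f0)
threshold f n (suc b) f0≤n n<fb with f b ≤? n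
... | yes fb≤n = b , fb≤n , n<fb
... | no  fb≰n = threshold f n b f0≤n (≰⇒> fb≰n)

^-swap : ∀ x a b → (x ^ a) ^ b ≡ (x ^ b) ^ a
^-swap x a b = trans (^-*-assoc x a b) (trans (cong (x ^_) (*-comm a b)) (sym (^-*-assoc x b a)))

module _ (p q : ℕ) {{p≢0 : NonZero p}} {{q≢0 : NonZero q}} where

  open ≤-Reasoning

  -- The side is chosen so that the next larger one no longer fits. The search runs over the side
  -- minus one, so the side is at least 1 and the next one is at most its double; this is the factor
  -- 2 in the constant.
  grid-size : ∀ n → p ^ q ≤ n →
              ∃ λ m → (p * m) ^ q ≤ n × n ^ p ≤ ((2 * p) ^ q) ^ p * (m ^ p) ^ q
  grid-size n n₀≤n = let m , fits , n<K = threshold (λ m → (p * suc m) ^ q) n n (subst (λ x → x ^ q ≤ n) (sym (*-identityʳ p)) n₀≤n) big in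
    suc m , fits , (begin
      n ^ p                                  ≤⟨ ^-monoˡ-≤ p (≤-trans (<⇒≤ n<K) (^-monoˡ-≤ q (double m))) ⟩
      ((2 * p * suc m) ^ q) ^ p              ≡⟨ cong (_^ p) (*-^-distrib (2 * p) (suc m) q) ⟩
      ((2 * p) ^ q * suc m ^ q) ^ p          ≡⟨ *-^-distrib ((2 * p) ^ q) (suc m ^ q) p ⟩
      ((2 * p) ^ q) ^ p * (suc m ^ q) ^ p    ≡⟨ cong (((2 * p) ^ q) ^ p *_) (^-swap (suc m) q p) ⟩
      ((2 * p) ^ q) ^ p * (suc m ^ p) ^ q    ∎)
    where
    big : n < (p * suc n) ^ q
    big = begin-strict
      n                  <⟨ n<1+n n ⟩
      suc n              ≤⟨ m≤n*m (suc n) p ⟩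
      p * suc n          ≡⟨ ^-identityʳ (p * suc n) ⟨
      (p * suc n) ^ 1    ≤⟨ ^-monoʳ-≤ (p * suc n) {{m*n≢0 p (suc n)}} (>-nonZero⁻¹ q) ⟩
      (p * suc n) ^ q    ∎
    lem : ∀ p m → p * suc (suc m) + p * m ≡ 2 * p * suc m
    lem = solve-∀
    double : ∀ m → p * suc (suc m) ≤ 2 * p * suc m
    double m = subst (p * suc (suc m) ≤_) (lem p m) (m≤m+n _ _)

  [m+n]^q≤ : ∀ a b → (a + b) ^ q ≤ 2 ^ q * (a ^ q + b ^ q)
  [m+n]^q≤ a b = begin
    (a + b) ^ q                 ≤⟨ ^-monoˡ-≤ q (+-mono-≤ (m≤m⊔n a b) (m≤n⊔m a b)) ⟩
    ((a ⊔ b) + (a ⊔ b)) ^ q     ≡⟨ cong (λ r → ((a ⊔ b) + r) ^ q) (+-identityʳ (a ⊔ b)) ⟨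
    (2 * (a ⊔ b)) ^ q           ≡⟨ *-^-distrib 2 (a ⊔ b) q ⟩
    2 ^ q * (a ⊔ b) ^ q         ≤⟨ *-monoʳ-≤ (2 ^ q) (max-bound (⊔-sel a b)) ⟩
    2 ^ q * (a ^ q + b ^ q)     ∎
    where
    max-bound : a ⊔ b ≡ a ⊎ a ⊔ b ≡ b → (a ⊔ b) ^ q ≤ a ^ q + b ^ q
    max-bound (inj₁ eq) = subst (λ x → x ^ q ≤ a ^ q + b ^ q) (sym eq) (m≤m+n _ _)
    max-bound (inj₂ eq) = subst (λ x → x ^ q ≤ a ^ q + b ^ q) (sym eq) (m≤n+m _ _)

  -- The linear contribution of the conflicting clauses is absorbed by `n ^ p`, as `q ≤ p` and `n`
  -- is positive.
  total-bound : q ≤ p → ∀ {N G n} {{_ : NonZero n}} → N ≤ n * q + G → G ^ q ≤ n ^ p →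
                N ^ q ≤ 2 ^ q * suc (q ^ q) * n ^ p
  total-bound q≤p {N} {G} {n} N≤ G^q≤ = begin
    N ^ q                              ≤⟨ ^-monoˡ-≤ q N≤ ⟩
    (n * q + G) ^ q                    ≤⟨ [m+n]^q≤ (n * q) G ⟩
    2 ^ q * ((n * q) ^ q + G ^ q)      ≤⟨ *-monoʳ-≤ (2 ^ q) (+-mono-≤ linear G^q≤) ⟩
    2 ^ q * (n ^ p * q ^ q + n ^ p)    ≡⟨ lem (2 ^ q) (n ^ p) (q ^ q) ⟩
    2 ^ q * suc (q ^ q) * n ^ p        ∎
    where
    linear : (n * q) ^ q ≤ n ^ p * q ^ q
    linear = subst (_≤ n ^ p * q ^ q) (sym (*-^-distrib n q q)) (*-monoˡ-≤ (q ^ q) (^-monoʳ-≤ n q≤p))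
    lem : ∀ x y z → x * (y * z + y) ≡ x * suc z * y
    lem = solve-∀

  -- After raising to the power `p`, the identity `p * t ≡ q * D` allows a `D`-th root on both
  -- sides. The exponents coming from the cover disappear, which keeps the constants independent of
  -- the family.
  root-bound : ∀ {G n t D} {{_ : NonZero D}} → p * t ≡ q * D → G ^ t ≤ n ^ D → G ^ q ≤ n ^ p
  root-bound {G} {n} {t} {D} pt≡qD le = ^-cancelʳ-≤ D (begin
    (G ^ q) ^ D    ≡⟨ ^-*-assoc G q D ⟩
    G ^ (q * D)    ≡⟨ cong (G ^_) pt≡qD ⟨
    G ^ (p * t)    ≡⟨ cong (G ^_) (*-comm p t) ⟩
    G ^ (t * p)    ≡⟨ ^-*-assoc G t p ⟨
    (G ^ t) ^ p    ≤⟨ ^-monoˡ-≤ p le ⟩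
    (n ^ D) ^ p    ≡⟨ ^-swap n D p ⟩
    (n ^ p) ^ D    ∎)

  Bounds : Family p q → ℕ → Set
  Bounds F n = (∃ λ Y → NonRedundant {n = n} (OR-DP F) Y × n ^ p ≤ ((2 * p) ^ q) ^ p * length Y ^ q) ×
               (∀ Y → NonRedundant {n = n} (OR-DP F) Y → length Y ^ q ≤ 2 ^ q * suc (q ^ q) * n ^ p)

  bounds-from-cover : q ≤ p → (F : Family p q) (J : List (Fin (arity F))) → NonZero (length J) →
                      (∀ i → p * length (filterᵇ (λ j → contains (memb F j) i) J) ≡ q * length J) →
                      ∀ n → p ^ q ≤ n → Bounds F n
  bounds-from-cover q≤p F J |J|≢0 cover n n₀≤n =
    let m , fits , n^p≤ = grid-size n n₀≤n
        open Lower F position fits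
    in (L.tabulate clause , nonRedundant ,
        subst (λ l → n ^ p ≤ ((2 * p) ^ q) ^ p * l ^ q) (sym (length-tabulate clause)) n^p≤) ,
       λ Y nr → total-bound q≤p (Upper.length-bound Y nr)
                  (root-bound {{|J|≢0}} (cover i₀) (Upper.consistents-bound Y nr))
    where
    i₀ : Fin p
    i₀ = fromℕ< (>-nonZero⁻¹ p)
    -- Cancelling `p` shows that all coordinates have the same count, so the count at one of them
    -- serves as `t`; it is nonzero because `q` and `length J` are.
    t = length (filterᵇ (λ j → contains (memb F j) i₀) J)
    instance
      t≢0 : NonZero t
      t≢0 = m*n≢0⇒n≢0 p {{subst NonZero (sym (cover i₀)) (m*n≢0 q (length J) {{q≢0}} {{|J|≢0}})}}
      n≢0 : NonZero n
      n≢0 = >-nonZero (≤-trans (m^n>0 p q) n₀≤n)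
    open Uniform F J t (λ i → *-cancelˡ-≡ _ t p (trans (cover i) (sym (cover i₀))))

  bounds : q ≤ p → ∀ F → Regular F → ∀ n → p ^ q ≤ n → Bounds F n
  bounds q≤p F regular =
    let J , |J|≢0 , cover = regular⇒uniform-cover F regular in bounds-from-cover q≤p F J |J|≢0 cover

theorem3p13 : ∀ (p q : ℕ) → 1 ≤ q → q ≤ p →
    Σ ℕ λ A → Σ ℕ λ B → Σ ℕ λ n₀ →
    ∀ (F : Family p q) → Regular F → ∀ (n : ℕ) → n₀ ≤ n →
    (Σ (List (Clause n (arity F))) λ Y →
    NonRedundant (OR-DP F) Y × (n ^ p ≤ A * length Y ^ q))
    × (∀ (Y : List (Clause n (arity F))) →
    NonRedundant (OR-DP F) Y → length Y ^ q ≤ B * n ^ p)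
-- The order n^{p/q} is expressed through `q`-th powers. From `p ^ q` on, a grid of side 1 fits; all
-- three constants are fixed before the family.
theorem3p13 p q 1≤q q≤p = ((2 * p) ^ q) ^ p , 2 ^ q * suc (q ^ q) , p ^ q ,
  bounds p q {{>-nonZero (≤-trans 1≤q q≤p)}} {{>-nonZero 1≤q}} q≤p
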